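{- Let $A$ be an $m\times m$ coloring matrix, let $m'\ge1$, and let $A'$ be the $(m+m')\times(m+m')$ block matrix $$A'=\left[\begin{array}{c|c}A&0\\\hline \mathbf{1}&I\end{array}\right],$$ where $\mathbf{1}$ is the $m'\times m$ all-ones matrix, $I$ is the $m'\times m'$ identity matrix and the upper right block is zero. Then $$\frac{1}{m'}F_{A'}(x)^2+\left(\frac{m'-2}{m'}F_A(x)-1\right)F_{A'}(x)+\left(F_A(x)-\frac{m'-1}{m'}F_A(x)^2+m'x\right)=0,$$ and consequently $$F_{A'}(x)=\frac{m'-(m'-2)F_A(x)}{2}-\frac{\sqrt{(m'-(m'-2)F_A(x))^2-4(m'F_A(x)-(m'-1)F_A(x)^2+(m')^2x)}}{2}.$$
   Context: A plane tree is an unlabeled rooted tree in which the children of every vertex are linearly ordered. A coloring matrix is a square matrix $A=(a_{ij})$ with entries in $\{0,1\}$. An $A$-coloring of a plane tree assigns to each vertex a color (an index of a row of $A$) such that whenever a vertex of color $j$ is a child of a vertex of color $i$, $a_{ij}=1$. Let $t_A(n)$ be the number of pairs (plane tree with $n$ vertices, $A$-coloring of it), and $F_A(x)=\sum_{n\ge1}t_A(n)x^n$ (formal power series). -}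

module Defs where

open import Data.Fin as Fin using (Fin; zero; suc; toℕ)
open import Data.Fin.Patterns using (0F; 1F)
import Data.Fin.Properties as Fin
import Data.Integer as ℤ
open import Data.List using (List; []; _∷_; map; concatMap; cartesianProductWith; deduplicate; lookup; length; allFin)
open import Data.List.Membership.Propositional using (_∈_)
open import Data.List.Membership.Propositional.Properties using (∈-map⁺; ∈-concatMap⁺; ∈-cartesianProductWith⁺; ∈-allFin; ∈-lookup; ∈-deduplicate⁺)
open import Data.List.Relation.Unary.All as All using (All; []; _∷_)
open import Data.List.Relation.Unary.AllPairs using (_∷_)
open import Data.List.Relation.Unary.Any as Any using (Any; here; there)
open import Data.List.Relation.Unary.Any.Properties using (lookup-index)
open import Data.List.Relation.Unary.Unique.Propositional using (Unique)
import Data.List.Relation.Unary.Unique.DecPropositional.Properties as UniqueDec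
open import Data.Nat as ℕ using (ℕ; zero; suc; _∸_; z≤n; s≤s)
import Data.Nat.Properties as ℕ
open import Data.Product using (Σ; Σ-syntax; _×_; _,_; proj₁)
open import Data.Product.Properties using (≡-dec)
open import Data.Rational as ℚ using (ℚ; 0ℚ; 1ℚ; _/_)
import Data.Rational.Properties as ℚ
open import Data.Unit using (⊤; tt)
open import Data.Vec.Functional using (Vector; zipWith; _++_)
open import Function using (_↔_; mk↔ₛ′)
open import Relation.Binary using (DecidableEquality)
open import Relation.Binary.PropositionalEquality using (_≡_; refl; sym; cong; cong₂)
open import Relation.Binary.PropositionalEquality.WithK using (≡-irrelevant)
open import Relation.Nullary using (Dec; yes; no; contradiction)
open import Relation.Nullary.Decidable using (_×-dec_; map′; ⌊_⌋)
open import Data.Bool using (if_then_else_)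
open import Algebra.Bundles using (CommutativeRing)
open import Algebra.Properties.Semiring.Sum (CommutativeRing.semiring ℚ.+-*-commutativeRing) using (sum-syntax)

Matrix : ℕ → ℕ → Set
Matrix m n = Vector (Vector (Fin 2) n) m

ColoringMatrix : ℕ → Set
ColoringMatrix m = Matrix m m

zeros : ∀ m n → Matrix m n
zeros m n _ _ = 0F

ones : ∀ m n → Matrix m n
ones m n _ _ = 1F

identity : ∀ m → Matrix m m
identity m i j = if ⌊ i Fin.≟ j ⌋ then 1F else 0F

--  ⎡ A │ B ⎤
--  ⎢───┼───⎥
--  ⎣ C │ D ⎦
block : ∀ {m₁ m₂ n₁ n₂} →
        Matrix m₁ n₁ → Matrix m₁ n₂ →
        Matrix m₂ n₁ → Matrix m₂ n₂ →
        Matrix (m₁ ℕ.+ m₂) (n₁ ℕ.+ n₂)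
block A B C D = zipWith _++_ A B ++ zipWith _++_ C D

extend : ∀ {m} → ColoringMatrix m → ∀ m′ → ColoringMatrix (m ℕ.+ m′)
extend {m} A m′ = block A (zeros m m′) (ones m′ m) (identity m′)

data PlaneTree : Set where
  node : List PlaneTree → PlaneTree

mutual
  #vertices : PlaneTree → ℕ
  #vertices (node ts) = suc (#verticesᶠ ts)

  #verticesᶠ : List PlaneTree → ℕ
  #verticesᶠ []       = 0
  #verticesᶠ (t ∷ ts) = #vertices t ℕ.+ #verticesᶠ ts

data Coloring (m : ℕ) : PlaneTree → Set where
  node : ∀ {ts} → Fin m → All (Coloring m) ts → Coloring m (node ts)

rootColor : ∀ {m t} → Coloring m t → Fin m
rootColor (node i _) = i

mutual
  IsAColoring : ∀ {m t} → ColoringMatrix m → Coloring m t → Set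
  IsAColoring A (node i cs) = ChildrenOK A i cs

  ChildrenOK : ∀ {m ts} → ColoringMatrix m → Fin m → All (Coloring m) ts → Set
  ChildrenOK A i []       = ⊤
  ChildrenOK A i (c ∷ cs) =
    A i (rootColor c) ≡ 1F × IsAColoring A c × ChildrenOK A i cs

ColoredTree : ∀ {m} → ColoringMatrix m → ℕ → Set
ColoredTree {m} A n =
  Σ[ t ∈ PlaneTree ] #vertices t ≡ n × Σ[ c ∈ Coloring m t ] IsAColoring A c

Finite : Set → Set
Finite X = Σ[ k ∈ ℕ ] Fin k ↔ X

private
  lookup-injective : ∀ {X : Set} {xs : List X} → Unique xs →
                     ∀ i j → lookup xs i ≡ lookup xs j → i ≡ j
  lookup-injective (_ ∷ _)   zero    zero    _  = refl
  lookup-injective (x∉ ∷ _)  zero    (suc j) eq = contradiction eq (All.lookup x∉ (∈-lookup j))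
  lookup-injective (x∉ ∷ _)  (suc i) zero    eq = contradiction (sym eq) (All.lookup x∉ (∈-lookup i))
  lookup-injective (_ ∷ xs!) (suc i) (suc j) eq = cong suc (lookup-injective xs! i j eq)

  enumerable⇒finite : ∀ {X : Set} → DecidableEquality X →
                      (xs : List X) → (∀ x → x ∈ xs) → Finite X
  enumerable⇒finite {X} _≟_ xs all∈ =
    length ys , mk↔ₛ′ (lookup ys) index lookup∘index
      (λ i → lookup-injective (UniqueDec.deduplicate-! _≟_ xs) _ _ (lookup∘index (lookup ys i)))
    where
    ys : List X
    ys = deduplicate _≟_ xs

    ∈ys : ∀ x → x ∈ ys
    ∈ys x = ∈-deduplicate⁺ _≟_ (all∈ x)

    index : X → Fin (length ys)
    index x = Any.index (∈ys x)

    lookup∘index : ∀ x → lookup ys (index x) ≡ x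
    lookup∘index x = sym (lookup-index (∈ys x))

  pairs : ∀ {X : Set} {P : X → Set} → List X → (∀ x → List (P x)) → List (Σ X P)
  pairs xs ps = concatMap (λ x → map (x ,_) (ps x)) xs

  ∈-pairs : ∀ {X : Set} {P : X → Set} {xs : List X} {ps : ∀ x → List (P x)} {x p} →
            x ∈ xs → p ∈ ps x → (x , p) ∈ pairs xs ps
  ∈-pairs {ps = ps} x∈ p∈ =
    ∈-concatMap⁺ (λ x → map (x ,_) (ps x)) (Any.map (λ { refl → ∈-map⁺ _ p∈ }) x∈)

  proofs : ∀ {P : Set} → Dec P → List P
  proofs (yes p) = p ∷ []
  proofs (no _)  = []

  ∈-proofs : ∀ {P : Set} (P? : Dec P) → (∀ (p q : P) → p ≡ q) → ∀ p → p ∈ proofs P?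
  ∈-proofs (yes q) irr p = here (irr p q)
  ∈-proofs (no ¬p) irr p = contradiction p ¬p

  forests : ℕ → List (List PlaneTree)
  forests zero    = [] ∷ []
  forests (suc n) = [] ∷ cartesianProductWith (λ ts us → node ts ∷ us) (forests n) (forests n)

  ∈-forests : ∀ n ts → #verticesᶠ ts ℕ.≤ n → ts ∈ forests n
  ∈-forests zero    []             _       = here refl
  ∈-forests zero    (node _ ∷ _)   ()
  ∈-forests (suc n) []             _       = here refl
  ∈-forests (suc n) (node ts ∷ us) (s≤s p) = there
    (∈-cartesianProductWith⁺ (λ ts us → node ts ∷ us)
      (∈-forests n ts (ℕ.≤-trans (ℕ.m≤m+n _ _) p))
      (∈-forests n us (ℕ.≤-trans (ℕ.m≤n+m _ (#verticesᶠ ts)) p)))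

  mutual
    colorings : ∀ m t → List (Coloring m t)
    colorings m (node ts) = cartesianProductWith node (allFin m) (coloringsᶠ m ts)

    coloringsᶠ : ∀ m ts → List (All (Coloring m) ts)
    coloringsᶠ m []       = [] ∷ []
    coloringsᶠ m (t ∷ ts) = cartesianProductWith _∷_ (colorings m t) (coloringsᶠ m ts)

  mutual
    ∈-colorings : ∀ {m t} (c : Coloring m t) → c ∈ colorings m t
    ∈-colorings (node i cs) = ∈-cartesianProductWith⁺ node (∈-allFin i) (∈-coloringsᶠ cs)

    ∈-coloringsᶠ : ∀ {m ts} (cs : All (Coloring m) ts) → cs ∈ coloringsᶠ m ts
    ∈-coloringsᶠ []       = here refl
    ∈-coloringsᶠ (c ∷ cs) = ∈-cartesianProductWith⁺ _∷_ (∈-colorings c) (∈-coloringsᶠ cs)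

  mutual
    isAColoring? : ∀ {m t} (A : ColoringMatrix m) (c : Coloring m t) → Dec (IsAColoring A c)
    isAColoring? A (node i cs) = childrenOK? A i cs

    childrenOK? : ∀ {m ts} (A : ColoringMatrix m) i (cs : All (Coloring m) ts) → Dec (ChildrenOK A i cs)
    childrenOK? A i []       = yes tt
    childrenOK? A i (c ∷ cs) =
      A i (rootColor c) Fin.≟ 1F ×-dec isAColoring? A c ×-dec childrenOK? A i cs

  mutual
    isAColoring-irr : ∀ {m t} (A : ColoringMatrix m) (c : Coloring m t)
                      (p q : IsAColoring A c) → p ≡ q
    isAColoring-irr A (node i cs) = childrenOK-irr A i cs

    childrenOK-irr : ∀ {m ts} (A : ColoringMatrix m) i (cs : All (Coloring m) ts)
                     (p q : ChildrenOK A i cs) → p ≡ q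
    childrenOK-irr A i []       tt           tt              = refl
    childrenOK-irr A i (c ∷ cs) (p , q , r) (p′ , q′ , r′) =
      cong₂ _,_ (≡-irrelevant p p′)
        (cong₂ _,_ (isAColoring-irr A c q q′) (childrenOK-irr A i cs r r′))

  mutual
    _≟ᵗ_ : DecidableEquality PlaneTree
    node ts ≟ᵗ node us = map′ (cong node) (λ { refl → refl }) (ts ≟ᶠ us)

    _≟ᶠ_ : DecidableEquality (List PlaneTree)
    []       ≟ᶠ []       = yes refl
    []       ≟ᶠ (_ ∷ _)  = no λ ()
    (_ ∷ _)  ≟ᶠ []       = no λ ()
    (t ∷ ts) ≟ᶠ (u ∷ us) =
      map′ (λ { (refl , refl) → refl }) (λ { refl → refl , refl }) (t ≟ᵗ u ×-dec ts ≟ᶠ us)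

  mutual
    _≟ᶜ_ : ∀ {m t} → DecidableEquality (Coloring m t)
    node i cs ≟ᶜ node j ds =
      map′ (λ { (refl , refl) → refl }) (λ { refl → refl , refl }) (i Fin.≟ j ×-dec cs ≟ᶜᶠ ds)

    _≟ᶜᶠ_ : ∀ {m ts} → DecidableEquality (All (Coloring m) ts)
    []       ≟ᶜᶠ []       = yes refl
    (c ∷ cs) ≟ᶜᶠ (d ∷ ds) =
      map′ (λ { (refl , refl) → refl }) (λ { refl → refl , refl }) (c ≟ᶜ d ×-dec cs ≟ᶜᶠ ds)

ColoredTree-finite : ∀ {m} (A : ColoringMatrix m) n → Finite (ColoredTree A n)
ColoredTree-finite {m} A n = enumerable⇒finite
  (≡-dec _≟ᵗ_ (≡-dec (λ p q → yes (≡-irrelevant p q))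
    (≡-dec _≟ᶜ_ (λ {c} p q → yes (isAColoring-irr A c p q)))))
  (pairs (map node (forests n)) λ t →
    pairs (proofs (#vertices t ℕ.≟ n)) λ _ →
      pairs (colorings m t) λ c → proofs (isAColoring? A c))
  λ { (node ts , refl , c , ok) →
    ∈-pairs (∈-map⁺ node (∈-forests n ts (ℕ.n≤1+n _)))
      (∈-pairs (∈-proofs (n ℕ.≟ n) ≡-irrelevant refl)
        (∈-pairs (∈-colorings c)
          (∈-proofs (isAColoring? A c) (isAColoring-irr A c) ok))) }

tree-count : ∀ {m} → ColoringMatrix m → ℕ → ℕ
tree-count A n = proj₁ (ColoredTree-finite A n)

infix  4 _≈_
infixl 6 _⊕_ _⊖_
infixl 7 _⊛_ _·_
infix  8 _²

PowerSeries : Set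
PowerSeries = ℕ → ℚ

_≈_ : PowerSeries → PowerSeries → Set
f ≈ g = ∀ n → f n ≡ g n

const : ℚ → PowerSeries
const q zero    = q
const q (suc _) = 0ℚ

X : PowerSeries
X 1 = 1ℚ
X _ = 0ℚ

_⊕_ _⊖_ _⊛_ : PowerSeries → PowerSeries → PowerSeries
(f ⊕ g) n = f n ℚ.+ g n
(f ⊖ g) n = f n ℚ.- g n
(f ⊛ g) n = ∑[ k < suc n ] (f (toℕ k) ℚ.* g (n ∸ toℕ k))

_·_ : ℚ → PowerSeries → PowerSeries
(q · f) n = q ℚ.* f n

_² : PowerSeries → PowerSeries
f ² = f ⊛ f

-- S = √D for the branch with positive constant term; for a given D there is
-- at most one such S, and there is none if D has constant term 0.
record _IsSqrtOf_ (S D : PowerSeries) : Set where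
  field
    squares  : S ² ≈ D
    positive : 0ℚ ℚ.< S 0

F : ∀ {m} → ColoringMatrix m → PowerSeries
F A zero    = 0ℚ
F A (suc n) = ℤ.+ tree-count A (suc n) / 1

{-# OPTIONS --safe #-}

-- Grade the A-colored trees by root color. Cutting off the leftmost subtree at
-- the root gives, for the series R i of trees with root color i,
--   R i = x + (∑ of R j over the colors j allowed below i) · R i.
-- In A′ an old color only sees old colors, so its series is unchanged, while a
-- new color i sees every old color and itself: G i = x + (F_A + G i) · G i.
-- Two solutions g, h of this equation satisfy (g − h)(1 − F_A − g − h) = 0, so
-- all G i are equal to one series G, and F_{A′} = F_A + m′ G. Eliminating G gives
-- the quadratic equation; completing the square, m′ − (m′ − 2) F_A − 2 F_{A′} is
-- the square root of the discriminant with constant term m′ > 0.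

module Submission where

open import Defs
open import Algebra.Bundles using (CommutativeRing)
open import Data.Fin as Fin using (Fin; zero; suc; toℕ; fromℕ; inject₁; opposite; splitAt; _↑ˡ_; _↑ʳ_)
open import Data.Fin.Patterns using (0F; 1F)
import Data.Fin.Permutation as Perm
import Data.Fin.Properties as Fin
open import Data.Integer as ℤ using (+_; _-_; _*_)
import Data.Integer.Properties as ℤ
open import Data.List using (List; []; _∷_)
open import Data.List.Relation.Unary.All using (All; []; _∷_)
open import Data.Nat as ℕ using (ℕ; zero; suc; NonZero; _∸_)
import Data.Nat.Induction as ℕ
import Data.Nat.Properties as ℕ
open import Data.Product using (Σ; Σ-syntax; _×_; ∃-syntax; _,_; proj₁; proj₂)
import Data.Product.Function.Dependent.Propositional as Σ
open import Data.Product.Function.NonDependent.Propositional using (_×-↔_)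
open import Data.Rational as ℚ using (ℚ; _/_; 0ℚ; 1ℚ; ½; toℚᵘ; fromℚᵘ)
import Data.Rational.Properties as ℚ
open import Data.Rational.Solver using (module +-*-Solver)
open import Data.Rational.Unnormalised as ℚᵘ using (mkℚᵘ; *≡*)
import Data.Rational.Unnormalised.Properties as ℚᵘ
open import Data.Sum using (_⊎_; inj₁; inj₂)
open import Data.Sum.Algebra using (⊎-assoc)
open import Data.Sum.Function.Propositional using (_⊎-↔_)
open import Data.Unit using (tt)
open import Data.Vec.Functional using (zipWith; _++_)
open import Data.Vec.Functional.Properties using (lookup-++ˡ; lookup-++ʳ)
open import Function using (_↔_; mk↔ₛ′; Inverse; _∘_)
open import Function.Construct.Composition using (_↔-∘_)
open import Function.Construct.Identity using (↔-id)
open import Function.Construct.Symmetry using (↔-sym)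
open import Function.Related.Propositional using (bijection)
open import Relation.Binary.PropositionalEquality using (_≡_; _≢_; refl; sym; trans; cong; cong₂; subst; module ≡-Reasoning)
open import Relation.Binary.PropositionalEquality.WithK using (≡-irrelevant)
open import Relation.Nullary using (¬_; yes; no; contradiction)
open import Algebra.Properties.Group ℚ.+-0-group using (x∙y⁻¹≈ε⇒x≈y)
open import Algebra.Properties.Semiring.Sum (CommutativeRing.semiring ℚ.+-*-commutativeRing)
  using (sum-syntax; sum-cong-≗; sum-replicate-zero; sum-init-last; *-distribˡ-sum; ∑-distrib-+; ∑-permute)
open +-*-Solver using (solve; con; _:+_; _:*_; _:-_; :-_; _:=_)
open ≡-Reasoning
open _IsSqrtOf_

-- Integers and fractions inside ℚ.

-- `toℚᵘ` respects sums and `fromℚᵘ` inverts it up to equality of fractions, so the sum can be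
-- carried through `toℚᵘ` and back.
fromℚᵘ-homo-+ : ∀ p q → fromℚᵘ (p ℚᵘ.+ q) ≡ fromℚᵘ p ℚ.+ fromℚᵘ q
fromℚᵘ-homo-+ p q = begin
  fromℚᵘ (p ℚᵘ.+ q)                                ≡⟨ ℚ.fromℚᵘ-cong (ℚᵘ.+-cong (ℚ.toℚᵘ-fromℚᵘ p) (ℚ.toℚᵘ-fromℚᵘ q)) ⟨
  fromℚᵘ (toℚᵘ (fromℚᵘ p) ℚᵘ.+ toℚᵘ (fromℚᵘ q))    ≡⟨ ℚ.fromℚᵘ-cong (ℚ.toℚᵘ-homo-+ (fromℚᵘ p) (fromℚᵘ q)) ⟨
  fromℚᵘ (toℚᵘ (fromℚᵘ p ℚ.+ fromℚᵘ q))            ≡⟨ ℚ.fromℚᵘ-toℚᵘ _ ⟩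
  fromℚᵘ p ℚ.+ fromℚᵘ q                            ∎

fromℚᵘ-homo-* : ∀ p q → fromℚᵘ (p ℚᵘ.* q) ≡ fromℚᵘ p ℚ.* fromℚᵘ q
fromℚᵘ-homo-* p q = begin
  fromℚᵘ (p ℚᵘ.* q)                                ≡⟨ ℚ.fromℚᵘ-cong (ℚᵘ.*-cong (ℚ.toℚᵘ-fromℚᵘ p) (ℚ.toℚᵘ-fromℚᵘ q)) ⟨
  fromℚᵘ (toℚᵘ (fromℚᵘ p) ℚᵘ.* toℚᵘ (fromℚᵘ q))    ≡⟨ ℚ.fromℚᵘ-cong (ℚ.toℚᵘ-homo-* (fromℚᵘ p) (fromℚᵘ q)) ⟨
  fromℚᵘ (toℚᵘ (fromℚᵘ p ℚ.* fromℚᵘ q))            ≡⟨ ℚ.fromℚᵘ-toℚᵘ _ ⟩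
  fromℚᵘ p ℚ.* fromℚᵘ q                            ∎

+-/1 : ∀ i j → (i ℤ.+ j) / 1 ≡ i / 1 ℚ.+ j / 1
+-/1 i j = trans
  -- The unnormalised sum has numerator `i * 1 + j * 1`, so the factors 1 are inserted first.
  (cong (_/ 1) (sym (cong₂ ℤ._+_ (ℤ.*-identityʳ i) (ℤ.*-identityʳ j))))
  (fromℚᵘ-homo-+ (mkℚᵘ i 0) (mkℚᵘ j 0))

*-/1 : ∀ i j → (i * j) / 1 ≡ i / 1 ℚ.* (j / 1)
*-/1 i j = fromℚᵘ-homo-* (mkℚᵘ i 0) (mkℚᵘ j 0)

/-as-* : ∀ i n .{{_ : NonZero n}} → i / n ≡ i / 1 ℚ.* (+ 1 / n)
/-as-* i n@(suc n-1) = trans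
  -- The unnormalised product has numerator `i * 1` and denominator `1 * n`, which computes to
  -- `n + 0`.
  (ℚ./-cong (sym (ℤ.*-identityʳ i)) (sym (ℕ.+-identityʳ n)))
  (fromℚᵘ-homo-* (mkℚᵘ i 0) (mkℚᵘ (+ 1) n-1))

n/n≡1 : ∀ n .{{_ : NonZero n}} → + n / n ≡ 1ℚ
n/n≡1 n@(suc n-1) = ℚ.fromℚᵘ-cong {mkℚᵘ (+ n) n-1} {mkℚᵘ (+ 1) 0} (*≡* (ℤ.*-comm (+ n) (+ 1)))

p*q≡0⇒p≡0 : ∀ {p q} → q ≢ 0ℚ → p ℚ.* q ≡ 0ℚ → p ≡ 0ℚ
p*q≡0⇒p≡0 {p} {q} q≢0 pq≡0 = begin
  p                         ≡⟨ ℚ.*-identityʳ p ⟨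
  p ℚ.* 1ℚ                  ≡⟨ cong (p ℚ.*_) (ℚ.*-inverseʳ q) ⟨
  p ℚ.* (q ℚ.* (ℚ.1/ q))    ≡⟨ ℚ.*-assoc p q (ℚ.1/ q) ⟨
  p ℚ.* q ℚ.* (ℚ.1/ q)      ≡⟨ cong (ℚ._* (ℚ.1/ q)) pq≡0 ⟩
  0ℚ ℚ.* (ℚ.1/ q)           ≡⟨ ℚ.*-zeroˡ (ℚ.1/ q) ⟩
  0ℚ                        ∎
  where instance _ = ℚ.≢-nonZero q≢0

p-q≡0⇒p≡q : ∀ {p q} → p ℚ.- q ≡ 0ℚ → p ≡ q
p-q≡0⇒p≡q {p} {q} = x∙y⁻¹≈ε⇒x≈y p q

2ℚ : ℚ
2ℚ = + 2 / 1

-- Power series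

const-0 : ∀ n → const 0ℚ n ≡ 0ℚ
const-0 zero    = refl
const-0 (suc n) = refl

⊖≈0⇒≈ : ∀ {f g} → f ⊖ g ≈ const 0ℚ → f ≈ g
⊖≈0⇒≈ eq zero    = p-q≡0⇒p≡q (eq zero)
⊖≈0⇒≈ eq (suc n) = p-q≡0⇒p≡q (eq (suc n))

term : PowerSeries → PowerSeries → ∀ n → Fin (suc n) → ℚ
term f g n k = f (toℕ k) ℚ.* g (n ∸ toℕ k)

⊛-cong : ∀ {f f′ g g′} → f ≈ f′ → g ≈ g′ → f ⊛ g ≈ f′ ⊛ g′
⊛-cong f≈f′ g≈g′ n = sum-cong-≗ λ (k : Fin (suc n)) → cong₂ ℚ._*_ (f≈f′ (toℕ k)) (g≈g′ (n ∸ toℕ k))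

-- The substitution k ↦ n - k, which is `opposite` on the indices, exchanges the two factors.
⊛-comm : ∀ f g → f ⊛ g ≈ g ⊛ f
⊛-comm f g n = begin
  ∑[ k < suc n ] (f (toℕ k) ℚ.* g (n ∸ toℕ k))                       ≡⟨ ∑-permute (term f g n) Perm.reverse ⟩
  ∑[ k < suc n ] (f (toℕ (opposite k)) ℚ.* g (n ∸ toℕ (opposite k))) ≡⟨ sum-cong-≗ swap ⟩
  ∑[ k < suc n ] (g (toℕ k) ℚ.* f (n ∸ toℕ k))                       ∎
  where
  swap : ∀ (k : Fin (suc n)) → f (toℕ (opposite k)) ℚ.* g (n ∸ toℕ (opposite k)) ≡ g (toℕ k) ℚ.* f (n ∸ toℕ k)
  swap k rewrite Fin.opposite-prop k | ℕ.m∸[m∸n]≡n (Fin.toℕ≤pred[n] k) = ℚ.*-comm (f (n ∸ toℕ k)) (g (toℕ k))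

⊛-distribʳ-⊕ : ∀ h f g → (f ⊕ g) ⊛ h ≈ f ⊛ h ⊕ g ⊛ h
⊛-distribʳ-⊕ h f g n = trans
  (sum-cong-≗ λ (k : Fin (suc n)) → ℚ.*-distribʳ-+ (h (n ∸ toℕ k)) (f (toℕ k)) (g (toℕ k)))
  (∑-distrib-+ (term f h n) (term g h n))

·-⊛-assoc : ∀ q f g → (q · f) ⊛ g ≈ q · (f ⊛ g)
·-⊛-assoc q f g n = trans
  (sum-cong-≗ λ (k : Fin (suc n)) → ℚ.*-assoc q (f (toℕ k)) (g (n ∸ toℕ k)))
  (sym (*-distribˡ-sum q (term f g n)))

⊖-as-⊕ : ∀ f g → f ⊖ g ≈ f ⊕ (ℚ.- 1ℚ) · g
⊖-as-⊕ f g n = solve 2 (λ a b → a :- b := a :+ (:- con 1ℚ) :* b) refl (f n) (g n)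

⊛-distribʳ-⊖ : ∀ h f g → (f ⊖ g) ⊛ h ≈ f ⊛ h ⊖ g ⊛ h
⊛-distribʳ-⊖ h f g n = begin
  ((f ⊖ g) ⊛ h) n                       ≡⟨ ⊛-cong {g = h} (⊖-as-⊕ f g) (λ _ → refl) n ⟩
  ((f ⊕ (ℚ.- 1ℚ) · g) ⊛ h) n            ≡⟨ ⊛-distribʳ-⊕ h f ((ℚ.- 1ℚ) · g) n ⟩
  (f ⊛ h ⊕ ((ℚ.- 1ℚ) · g) ⊛ h) n        ≡⟨ cong ((f ⊛ h) n ℚ.+_) (·-⊛-assoc (ℚ.- 1ℚ) g h n) ⟩
  (f ⊛ h ⊕ (ℚ.- 1ℚ) · (g ⊛ h)) n        ≡⟨ ⊖-as-⊕ (f ⊛ h) (g ⊛ h) n ⟨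
  (f ⊛ h ⊖ g ⊛ h) n                     ∎

const-⊛ : ∀ q f → const q ⊛ f ≈ q · f
const-⊛ q f n = begin
  q ℚ.* f n ℚ.+ ∑[ k < n ] (0ℚ ℚ.* f (n ∸ suc (toℕ k)))  ≡⟨ cong (q ℚ.* f n ℚ.+_) (sum-cong-≗ λ (k : Fin n) → ℚ.*-zeroˡ (f (n ∸ suc (toℕ k)))) ⟩
  q ℚ.* f n ℚ.+ ∑[ k < n ] 0ℚ                            ≡⟨ cong (q ℚ.* f n ℚ.+_) (sum-replicate-zero n) ⟩
  q ℚ.* f n ℚ.+ 0ℚ                                       ≡⟨ ℚ.+-identityʳ _ ⟩
  q ℚ.* f n                                              ∎

-- Strong induction on the coefficient: once the lower coefficients of `u` vanish, all that remains
-- of coefficient `n` of the product is its last summand `u n * v 0`.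
⊛-zeroˡ-cancel : ∀ u v → v 0 ≢ 0ℚ → u ⊛ v ≈ const 0ℚ → u ≈ const 0ℚ
⊛-zeroˡ-cancel u v v₀≢0 uv≈0 n = trans (coefficient n) (sym (const-0 n))
  where
  step : ∀ n → (∀ {k} → k ℕ.< n → u k ≡ 0ℚ) → u n ≡ 0ℚ
  step n lower = p*q≡0⇒p≡0 v₀≢0 (begin
    u n ℚ.* v 0                                          ≡⟨ cong₂ (λ a b → u a ℚ.* v b) (Fin.toℕ-fromℕ n) (trans (cong (n ∸_) (Fin.toℕ-fromℕ n)) (ℕ.n∸n≡0 n)) ⟨
    t (fromℕ n)                                          ≡⟨ ℚ.+-identityˡ _ ⟨
    0ℚ ℚ.+ t (fromℕ n)                                   ≡⟨ cong (ℚ._+ t (fromℕ n)) (sum-replicate-zero n) ⟨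
    ∑[ k < n ] 0ℚ ℚ.+ t (fromℕ n)                        ≡⟨ cong (ℚ._+ t (fromℕ n)) (sum-cong-≗ vanish) ⟨
    ∑[ k < n ] t (inject₁ k) ℚ.+ t (fromℕ n)             ≡⟨ sum-init-last t ⟨
    (u ⊛ v) n                                            ≡⟨ trans (uv≈0 n) (const-0 n) ⟩
    0ℚ                                                   ∎)
    where
    t = term u v n

    vanish : ∀ k → t (inject₁ k) ≡ 0ℚ
    vanish k rewrite Fin.toℕ-inject₁ k | lower (Fin.toℕ<n k) = ℚ.*-zeroˡ (v (n ∸ toℕ k))

  coefficient : ∀ n → u n ≡ 0ℚ
  coefficient = ℕ.<-rec _ step

∑-const : ∀ n q → ∑[ i < n ] q ≡ (+ n / 1) ℚ.* q
∑-const zero    q = sym (ℚ.*-zeroˡ q)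
∑-const (suc n) q = begin
  q ℚ.+ ∑[ i < n ] q               ≡⟨ cong (q ℚ.+_) (∑-const n q) ⟩
  q ℚ.+ (+ n / 1) ℚ.* q            ≡⟨ solve 2 (λ q n → q :+ n :* q := (con 1ℚ :+ n) :* q) refl q (+ n / 1) ⟩
  (1ℚ ℚ.+ + n / 1) ℚ.* q           ≡⟨ cong (ℚ._* q) (+-/1 (+ 1) (+ n)) ⟨
  (+ suc n / 1) ℚ.* q              ∎

-- Uniqueness of fixed points and of square roots.

-- Subtracting the two equations shows that `v` annihilates `g ⊖ h`. As `f`, `g` and `h` have
-- constant term 0, `v` has constant term 1 and can be cancelled.
fixpoint-unique : ∀ {f g h} → f 0 ≡ 0ℚ → g 0 ≡ 0ℚ → h 0 ≡ 0ℚ →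
                  g ≈ X ⊕ (f ⊕ g) ⊛ g → h ≈ X ⊕ (f ⊕ h) ⊛ h → g ≈ h
fixpoint-unique {f} {g} {h} f₀ g₀ h₀ g-eq h-eq =
  ⊖≈0⇒≈ (⊛-zeroˡ-cancel (g ⊖ h) v v₀≢0 λ n → trans (vanish n) (sym (const-0 n)))
  where
  v = const 1ℚ ⊖ (f ⊕ g ⊕ h)

  v₀≢0 : v 0 ≢ 0ℚ
  v₀≢0 rewrite f₀ | g₀ | h₀ = λ ()

  expand : ∀ k n → (k ⊛ v) n ≡ k n ℚ.- ((f ⊛ k) n ℚ.+ (g ⊛ k) n ℚ.+ (h ⊛ k) n)
  expand k n = begin
    (k ⊛ v) n                                       ≡⟨ ⊛-comm k v n ⟩
    (v ⊛ k) n                                       ≡⟨ ⊛-distribʳ-⊖ k (const 1ℚ) (f ⊕ g ⊕ h) n ⟩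
    (const 1ℚ ⊛ k) n ℚ.- ((f ⊕ g ⊕ h) ⊛ k) n        ≡⟨ cong₂ ℚ._-_ (trans (const-⊛ 1ℚ k n) (ℚ.*-identityˡ (k n)))
                                                        (trans (⊛-distribʳ-⊕ k (f ⊕ g) h n) (cong (ℚ._+ (h ⊛ k) n) (⊛-distribʳ-⊕ k f g n))) ⟩
    k n ℚ.- ((f ⊛ k) n ℚ.+ (g ⊛ k) n ℚ.+ (h ⊛ k) n) ∎

  solved : ∀ {k} → k ≈ X ⊕ (f ⊕ k) ⊛ k → ∀ n → k n ≡ X n ℚ.+ ((f ⊛ k) n ℚ.+ (k ⊛ k) n)
  solved {k} k-eq n = trans (k-eq n) (cong (X n ℚ.+_) (⊛-distribʳ-⊕ k f k n))

  vanish : ∀ n → ((g ⊖ h) ⊛ v) n ≡ 0ℚ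
  vanish n = begin
    ((g ⊖ h) ⊛ v) n              ≡⟨ ⊛-distribʳ-⊖ v g h n ⟩
    (g ⊛ v) n ℚ.- (h ⊛ v) n      ≡⟨ cong₂ ℚ._-_ (expand g n) (expand h n) ⟩
    g n ℚ.- (fg ℚ.+ gg ℚ.+ hg) ℚ.- (h n ℚ.- (fh ℚ.+ gh ℚ.+ hh))
                                 -- Only the isolated coefficients `g n` and `h n` are unfolded by
                                 -- their equations; the products then cancel as soon as `hg` is
                                 -- identified with `gh`.
                                 ≡⟨ cong₂ (λ a b → a ℚ.- (fg ℚ.+ gg ℚ.+ hg) ℚ.- (b ℚ.- (fh ℚ.+ gh ℚ.+ hh))) (solved {g} g-eq n) (solved {h} h-eq n) ⟩
    X n ℚ.+ (fg ℚ.+ gg) ℚ.- (fg ℚ.+ gg ℚ.+ hg) ℚ.- (X n ℚ.+ (fh ℚ.+ hh) ℚ.- (fh ℚ.+ gh ℚ.+ hh))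
                                 ≡⟨ cong (λ a → X n ℚ.+ (fg ℚ.+ gg) ℚ.- (fg ℚ.+ gg ℚ.+ a) ℚ.- (X n ℚ.+ (fh ℚ.+ hh) ℚ.- (fh ℚ.+ gh ℚ.+ hh))) (⊛-comm h g n) ⟩
    X n ℚ.+ (fg ℚ.+ gg) ℚ.- (fg ℚ.+ gg ℚ.+ gh) ℚ.- (X n ℚ.+ (fh ℚ.+ hh) ℚ.- (fh ℚ.+ gh ℚ.+ hh))
                                 ≡⟨ solve 6 (λ x fg gg gh fh hh → x :+ (fg :+ gg) :- (fg :+ gg :+ gh) :- (x :+ (fh :+ hh) :- (fh :+ gh :+ hh)) := con 0ℚ) refl (X n) fg gg gh fh hh ⟩
    0ℚ                           ∎
    where
    fg = (f ⊛ g) n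
    gg = (g ⊛ g) n
    hg = (h ⊛ g) n
    fh = (f ⊛ h) n
    gh = (g ⊛ h) n
    hh = (h ⊛ h) n

-- Difference of squares: the product of `S ⊖ T` and `S ⊕ T` is D - D, and the second factor has a
-- positive constant term, so it can be cancelled.
sqrt-unique : ∀ {S T D} → S IsSqrtOf D → T IsSqrtOf D → S ≈ T
sqrt-unique {S} {T} {D} √S √T = ⊖≈0⇒≈ (⊛-zeroˡ-cancel (S ⊖ T) (S ⊕ T) S₀+T₀≢0 λ n → trans (vanish n) (sym (const-0 n)))
  where
  S₀+T₀≢0 : S 0 ℚ.+ T 0 ≢ 0ℚ
  S₀+T₀≢0 = ℚ.<⇒≢ (ℚ.+-mono-< (positive √S) (positive √T)) ∘ sym

  vanish : ∀ n → ((S ⊖ T) ⊛ (S ⊕ T)) n ≡ 0ℚ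
  vanish n = begin
    ((S ⊖ T) ⊛ (S ⊕ T)) n                                 ≡⟨ ⊛-distribʳ-⊖ (S ⊕ T) S T n ⟩
    (S ⊛ (S ⊕ T)) n ℚ.- (T ⊛ (S ⊕ T)) n                   ≡⟨ cong₂ ℚ._-_ (expand S) (expand T) ⟩
    (S ²) n ℚ.+ (T ⊛ S) n ℚ.- ((S ⊛ T) n ℚ.+ (T ²) n)     ≡⟨ cong₂ (λ a b → a ℚ.+ (T ⊛ S) n ℚ.- ((S ⊛ T) n ℚ.+ b)) (squares √S n) (squares √T n) ⟩
    D n ℚ.+ (T ⊛ S) n ℚ.- ((S ⊛ T) n ℚ.+ D n)             ≡⟨ cong (λ a → D n ℚ.+ a ℚ.- ((S ⊛ T) n ℚ.+ D n)) (⊛-comm T S n) ⟩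
    D n ℚ.+ (S ⊛ T) n ℚ.- ((S ⊛ T) n ℚ.+ D n)             ≡⟨ solve 2 (λ d st → d :+ st :- (st :+ d) := con 0ℚ) refl (D n) ((S ⊛ T) n) ⟩
    0ℚ                                                    ∎
    where
    expand : ∀ U → (U ⊛ (S ⊕ T)) n ≡ (S ⊛ U) n ℚ.+ (T ⊛ U) n
    expand U = trans (⊛-comm U (S ⊕ T) n) (⊛-distribʳ-⊕ U S T n)

-- The quadratic equation and its discriminant.

-- The equation of the theorem multiplied by `μ`, the number of new colors, which clears the
-- denominators. It is stated coefficientwise so that the ring solver for ℚ can treat coefficients
-- of products as atoms.
Quadratic : ℚ → PowerSeries → PowerSeries → Set
Quadratic μ f f′ = ∀ n →
  (f′ ²) n ℚ.+ (μ ℚ.- 2ℚ) ℚ.* (f ⊛ f′) n ℚ.- μ ℚ.* f′ n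
    ℚ.+ (μ ℚ.* f n ℚ.- (μ ℚ.- 1ℚ) ℚ.* (f ²) n ℚ.+ μ ℚ.* μ ℚ.* X n) ≡ 0ℚ

quadratic : ∀ {f f′ g} μ → f′ ≈ f ⊕ μ · g → g ≈ X ⊕ (f ⊕ g) ⊛ g → Quadratic μ f f′
quadratic {f} {f′} {g} μ f′-eq g-eq n = begin
  (f′ ²) n ℚ.+ (μ ℚ.- 2ℚ) ℚ.* (f ⊛ f′) n ℚ.- μ ℚ.* f′ n ℚ.+ c
    ≡⟨ cong₂ (λ a b → a ℚ.+ (μ ℚ.- 2ℚ) ℚ.* b ℚ.- μ ℚ.* f′ n ℚ.+ c) f′f′ ff′ ⟩
  ff ℚ.+ μ ℚ.* fg ℚ.+ μ ℚ.* (fg ℚ.+ μ ℚ.* gg) ℚ.+ (μ ℚ.- 2ℚ) ℚ.* (ff ℚ.+ μ ℚ.* fg) ℚ.- μ ℚ.* f′ n ℚ.+ c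
    -- With the products expanded in `ff`, `fg` and `gg`, the equation for `g` is used only at the
    -- linear occurrence of `f′`. This produces the `fg` and `gg` that cancel the others.
    ≡⟨ cong (λ a → ff ℚ.+ μ ℚ.* fg ℚ.+ μ ℚ.* (fg ℚ.+ μ ℚ.* gg) ℚ.+ (μ ℚ.- 2ℚ) ℚ.* (ff ℚ.+ μ ℚ.* fg) ℚ.- μ ℚ.* a ℚ.+ c)
         (trans (f′-eq n) (cong (λ a → f n ℚ.+ μ ℚ.* a) (trans (g-eq n) (cong (X n ℚ.+_) (⊛-distribʳ-⊕ g f g n))))) ⟩
  ff ℚ.+ μ ℚ.* fg ℚ.+ μ ℚ.* (fg ℚ.+ μ ℚ.* gg) ℚ.+ (μ ℚ.- 2ℚ) ℚ.* (ff ℚ.+ μ ℚ.* fg) ℚ.- μ ℚ.* (f n ℚ.+ μ ℚ.* (X n ℚ.+ (fg ℚ.+ gg))) ℚ.+ c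
    ≡⟨ solve 6 (λ μ x f ff fg gg →
         ff :+ μ :* fg :+ μ :* (fg :+ μ :* gg) :+ (μ :- con 2ℚ) :* (ff :+ μ :* fg) :- μ :* (f :+ μ :* (x :+ (fg :+ gg)))
           :+ (μ :* f :- (μ :- con 1ℚ) :* ff :+ μ :* μ :* x) := con 0ℚ)
         refl μ (X n) (f n) ff fg gg ⟩
  0ℚ ∎
  where
  ff = (f ⊛ f) n
  fg = (f ⊛ g) n
  gg = (g ⊛ g) n
  c  = μ ℚ.* f n ℚ.- (μ ℚ.- 1ℚ) ℚ.* ff ℚ.+ μ ℚ.* μ ℚ.* X n

  f′⊛ : ∀ h → (f′ ⊛ h) n ≡ (f ⊛ h) n ℚ.+ μ ℚ.* (g ⊛ h) n
  f′⊛ h = begin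
    (f′ ⊛ h) n                     ≡⟨ ⊛-cong {g = h} f′-eq (λ _ → refl) n ⟩
    ((f ⊕ μ · g) ⊛ h) n            ≡⟨ ⊛-distribʳ-⊕ h f (μ · g) n ⟩
    (f ⊛ h) n ℚ.+ ((μ · g) ⊛ h) n  ≡⟨ cong ((f ⊛ h) n ℚ.+_) (·-⊛-assoc μ g h n) ⟩
    (f ⊛ h) n ℚ.+ μ ℚ.* (g ⊛ h) n  ∎

  ff′ : (f ⊛ f′) n ≡ ff ℚ.+ μ ℚ.* fg
  ff′ = trans (⊛-comm f f′ n) (trans (f′⊛ f) (cong (λ a → ff ℚ.+ μ ℚ.* a) (⊛-comm g f n)))

  f′f′ : (f′ ⊛ f′) n ≡ ff ℚ.+ μ ℚ.* fg ℚ.+ μ ℚ.* (fg ℚ.+ μ ℚ.* gg)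
  f′f′ = trans (f′⊛ f′) (cong₂ (λ a b → a ℚ.+ μ ℚ.* b) ff′ (trans (⊛-comm g f′ n) (f′⊛ g)))

-- The group `b ⊛ f` minus `f ²` is kept together because the quadratic equation, read as f′² - B f′
-- + d = 0, evaluates it to `d`.
complete-square : ∀ {b f} n → ((b ⊖ 2ℚ · f) ²) n ≡ (b ²) n ℚ.- (+ 4 / 1) ℚ.* ((b ⊛ f) n ℚ.- (f ²) n)
complete-square {b} {f} n = begin
  ((b ⊖ 2ℚ · f) ²) n                         ≡⟨ s⊛ (b ⊖ 2ℚ · f) ⟩
  (b ⊛ s) n ℚ.- 2ℚ ℚ.* (f ⊛ s) n             ≡⟨ cong₂ (λ x y → x ℚ.- 2ℚ ℚ.* y) (trans (⊛-comm b s n) (s⊛ b)) (trans (⊛-comm f s n) (s⊛ f)) ⟩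
  bb ℚ.- 2ℚ ℚ.* (f ⊛ b) n ℚ.- 2ℚ ℚ.* (bf ℚ.- 2ℚ ℚ.* ff) ≡⟨ cong (λ x → bb ℚ.- 2ℚ ℚ.* x ℚ.- 2ℚ ℚ.* (bf ℚ.- 2ℚ ℚ.* ff)) (⊛-comm f b n) ⟩
  bb ℚ.- 2ℚ ℚ.* bf ℚ.- 2ℚ ℚ.* (bf ℚ.- 2ℚ ℚ.* ff)         ≡⟨ solve 3 (λ bb bf ff → bb :- con 2ℚ :* bf :- con 2ℚ :* (bf :- con 2ℚ :* ff) := bb :- con (+ 4 / 1) :* (bf :- ff)) refl bb bf ff ⟩
  bb ℚ.- (+ 4 / 1) ℚ.* (bf ℚ.- ff) ∎
  where
  s  = b ⊖ 2ℚ · f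
  bb = (b ⊛ b) n
  bf = (b ⊛ f) n
  ff = (f ⊛ f) n

  s⊛ : ∀ h → (s ⊛ h) n ≡ (b ⊛ h) n ℚ.- 2ℚ ℚ.* (f ⊛ h) n
  s⊛ h = trans (⊛-distribʳ-⊖ h b (2ℚ · f) n) (cong (λ x → (b ⊛ h) n ℚ.- x) (·-⊛-assoc 2ℚ f h n))

-- Here `c` plays the role of 1/μ. The coefficients `p` and `q` are variables because the theorem
-- writes them as integer fractions, whose relation to `μ` is only propositional.
quadratic-divided : ∀ {μ c p q f f′} → μ ℚ.* c ≡ 1ℚ → p ≡ (μ ℚ.- 2ℚ) ℚ.* c → q ≡ (μ ℚ.- 1ℚ) ℚ.* c →
  Quadratic μ f f′ → c · f′ ² ⊕ (p · f ⊖ const 1ℚ) ⊛ f′ ⊕ (f ⊖ q · f ² ⊕ μ · X) ≈ const 0ℚ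
quadratic-divided {μ} {c} {p} {q} {f} {f′} μc≡1 refl refl quad n = begin
  c ℚ.* f′f′ ℚ.+ ((p · f ⊖ const 1ℚ) ⊛ f′) n ℚ.+ r
    ≡⟨ cong (λ a → c ℚ.* f′f′ ℚ.+ a ℚ.+ r)
         (trans (⊛-distribʳ-⊖ f′ (p · f) (const 1ℚ) n) (cong₂ ℚ._-_ (·-⊛-assoc p f f′ n) (const-⊛ 1ℚ f′ n))) ⟩
  c ℚ.* f′f′ ℚ.+ (p ℚ.* ff′ ℚ.- 1ℚ ℚ.* f′ n) ℚ.+ r
    -- The solver cannot use `μ * c ≡ 1ℚ`. Hence the terms f - f′ + μx, which acquire a factor
    -- `μ * c` when the quadratic is multiplied by `c`, are corrected by a multiple of 1 - μc.
    ≡⟨ solve 8 (λ c μ f f′ x f′f′ ff′ ff →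
         c :* f′f′ :+ ((μ :- con 2ℚ) :* c :* ff′ :- con 1ℚ :* f′) :+ (f :- (μ :- con 1ℚ) :* c :* ff :+ μ :* x)
         := c :* (f′f′ :+ (μ :- con 2ℚ) :* ff′ :- μ :* f′ :+ (μ :* f :- (μ :- con 1ℚ) :* ff :+ μ :* μ :* x))
            :+ (con 1ℚ :- μ :* c) :* (f :- f′ :+ μ :* x)) refl c μ (f n) (f′ n) (X n) f′f′ ff′ ff ⟩
  c ℚ.* (f′f′ ℚ.+ (μ ℚ.- 2ℚ) ℚ.* ff′ ℚ.- μ ℚ.* f′ n ℚ.+ (μ ℚ.* f n ℚ.- (μ ℚ.- 1ℚ) ℚ.* ff ℚ.+ μ ℚ.* μ ℚ.* X n))
    ℚ.+ (1ℚ ℚ.- μ ℚ.* c) ℚ.* e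
    ≡⟨ cong₂ (λ a b → c ℚ.* a ℚ.+ (1ℚ ℚ.- b) ℚ.* e) (quad n) μc≡1 ⟩
  c ℚ.* 0ℚ ℚ.+ 0ℚ ℚ.* e
    ≡⟨ cong₂ ℚ._+_ (ℚ.*-zeroʳ c) (ℚ.*-zeroˡ e) ⟩
  0ℚ
    ≡⟨ const-0 n ⟨
  const 0ℚ n ∎
  where
  f′f′ = (f′ ⊛ f′) n
  ff′  = (f ⊛ f′) n
  ff   = (f ⊛ f) n
  r    = f n ℚ.- q ℚ.* ff ℚ.+ μ ℚ.* X n
  e    = f n ℚ.- f′ n ℚ.+ μ ℚ.* X n

quadratic-discriminant : ∀ {μ p q r f f′} → p ≡ μ ℚ.- 2ℚ → q ≡ μ ℚ.- 1ℚ → r ≡ μ ℚ.* μ → Quadratic μ f f′ →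
  let B = const μ ⊖ p · f in (B ⊖ 2ℚ · f′) ² ≈ B ² ⊖ (+ 4 / 1) · (μ · f ⊖ q · f ² ⊕ r · X)
quadratic-discriminant {μ} {p} {f = f} {f′} refl refl refl quad n =
  trans (complete-square {B} {f′} n) (cong (λ a → (B ²) n ℚ.- (+ 4 / 1) ℚ.* a) (begin
    (B ⊛ f′) n ℚ.- f′f′
      ≡⟨ cong (ℚ._- f′f′) (trans (⊛-distribʳ-⊖ f′ (const μ) (p · f) n)
           (cong₂ ℚ._-_ (const-⊛ μ f′ n) (·-⊛-assoc p f f′ n))) ⟩
    μ ℚ.* f′ n ℚ.- (μ ℚ.- 2ℚ) ℚ.* ff′ ℚ.- f′f′
      -- Adding and subtracting `d` exposes the left-hand side of the quadratic equation.
      ≡⟨ solve 5 (λ μ f′ ff′ f′f′ d →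
           μ :* f′ :- (μ :- con 2ℚ) :* ff′ :- f′f′
           := d :- (f′f′ :+ (μ :- con 2ℚ) :* ff′ :- μ :* f′ :+ d)) refl μ (f′ n) ff′ f′f′ d ⟩
    d ℚ.- (f′f′ ℚ.+ (μ ℚ.- 2ℚ) ℚ.* ff′ ℚ.- μ ℚ.* f′ n ℚ.+ d)
      ≡⟨ cong (λ x → d ℚ.- x) (quad n) ⟩
    d ℚ.- 0ℚ
      ≡⟨ ℚ.+-identityʳ d ⟩
    d ∎))
  where
  B    = const μ ⊖ p · f
  f′f′ = (f′ ⊛ f′) n
  ff′  = (f ⊛ f′) n
  d    = μ ℚ.* f n ℚ.- (μ ℚ.- 1ℚ) ℚ.* (f ⊛ f) n ℚ.+ μ ℚ.* μ ℚ.* X n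

-- Selects the branch of the square root: for `μ` positive this root, rather than its negative, is
-- the admissible one.
sqrt-constant-term : ∀ {μ p f f′} → f 0 ≡ 0ℚ → f′ 0 ≡ 0ℚ → (const μ ⊖ p · f ⊖ 2ℚ · f′) 0 ≡ μ
sqrt-constant-term {μ} {p} f₀ f′₀ rewrite f₀ | f′₀ =
  solve 2 (λ μ p → μ :- p :* con 0ℚ :- con 2ℚ :* con 0ℚ := μ) refl μ p

half-difference : ∀ b f → f ≈ ½ · b ⊖ ½ · (b ⊖ 2ℚ · f)
half-difference b f n =
  solve 2 (λ b f → f := con ½ :* b :- con ½ :* (b :- con 2ℚ :* f)) refl (b n) (f n)

-- Counting

-- Serves the identity block, where the condition `E` singles out one color.
Σ-singleton : ∀ {I : Set} {E P : I → Set} {i} → (∀ {j} (e e′ : E j) → e ≡ e′) →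
              E i → (∀ {j} → E j → i ≡ j) → P i ↔ (Σ[ j ∈ I ] (E j × P j))
Σ-singleton {I} {E} {P} {i} irr eᵢ E⇒≡ = mk↔ₛ′ to from to∘from from∘to
  where
  to : P i → Σ[ j ∈ I ] (E j × P j)
  to p = i , eᵢ , p

  from : (Σ[ j ∈ I ] (E j × P j)) → P i
  from (j , e , p) = subst P (sym (E⇒≡ e)) p

  to∘from : ∀ x → to (from x) ≡ x
  to∘from (j , e , p) with E⇒≡ e
  ... | refl = cong (λ e → i , e , p) (irr eᵢ e)

  from∘to : ∀ p → from (to p) ≡ p
  -- `E⇒≡ eᵢ` is a loop at `i`, so by uniqueness of identity proofs the transport along it is
  -- trivial.
  from∘to p rewrite ≡-irrelevant (E⇒≡ eᵢ) refl = refl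

-- Serves the all-ones block, where the condition `E` always holds.
×-inhabited : ∀ {E P : Set} → (∀ (e e′ : E) → e ≡ e′) → E → P ↔ (E × P)
×-inhabited irr e = mk↔ₛ′ (e ,_) proj₂ (λ (e′ , p) → cong (_, p) (irr e e′)) (λ _ → refl)

Σ-Fin-suc : ∀ {n} {P : Fin (suc n) → Set} → (P zero ⊎ Σ (Fin n) (P ∘ suc)) ↔ Σ (Fin (suc n)) P
Σ-Fin-suc = mk↔ₛ′
  (λ { (inj₁ p) → zero , p ; (inj₂ (i , p)) → suc i , p })
  (λ { (zero , p) → inj₁ p ; (suc i , p) → inj₂ (i , p) })
  (λ { (zero , p) → refl ; (suc i , p) → refl })
  (λ { (inj₁ p) → refl ; (inj₂ (i , p)) → refl })

Σ-Fin-+ : ∀ m {n} {P : Fin (m ℕ.+ n) → Set} →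
          (Σ[ i ∈ Fin m ] P (i ↑ˡ n) ⊎ Σ[ j ∈ Fin n ] P (m ↑ʳ j)) ↔ Σ (Fin (m ℕ.+ n)) P
Σ-Fin-+ zero    = mk↔ₛ′ (λ { (inj₂ p) → p ; (inj₁ ()) }) inj₂ (λ _ → refl) (λ { (inj₂ p) → refl ; (inj₁ ()) })
Σ-Fin-+ (suc m) = Σ-Fin-suc ↔-∘ ((↔-id _ ⊎-↔ Σ-Fin-+ m) ↔-∘ (⊎-assoc _ _ _ _ ↔-∘ (↔-sym Σ-Fin-suc ⊎-↔ ↔-id _)))

-- The Cauchy product at the level of sets. Storing the equation `k + l ≡ n` instead of a
-- subtraction makes it match the constructor `graft`.
data SizedPair (P Q : ℕ → Set) (n : ℕ) : Set where
  sizedPair : ∀ {k l} → k ℕ.+ l ≡ n → P k → Q l → SizedPair P Q n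

SizedPair-zero : ∀ {P Q} → (P 0 × Q 0) ↔ SizedPair P Q 0
SizedPair-zero {P} {Q} = mk↔ₛ′ to from (λ { (sizedPair {zero} {zero} refl _ _) → refl }) (λ _ → refl)
  where
  to : P 0 × Q 0 → SizedPair P Q 0
  to (p , q) = sizedPair refl p q

  from : SizedPair P Q 0 → P 0 × Q 0
  from (sizedPair {zero} {zero} _ p q) = p , q

-- The case split on the first size mirrors the sum defining `⊛`: its head is the summand with k =
-- 0, and its tail is the product with the first factor shifted by one.
SizedPair-suc : ∀ {P Q n} → ((P 0 × Q (suc n)) ⊎ SizedPair (P ∘ suc) Q n) ↔ SizedPair P Q (suc n)
SizedPair-suc {P} {Q} {n} = mk↔ₛ′ to from
  (λ { (sizedPair {zero} refl p q) → refl ; (sizedPair {suc _} refl p q) → refl })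
  (λ { (inj₁ (p , q)) → refl ; (inj₂ (sizedPair refl p q)) → refl })
  where
  to : (P 0 × Q (suc n)) ⊎ SizedPair (P ∘ suc) Q n → SizedPair P Q (suc n)
  to (inj₁ (p , q))            = sizedPair refl p q
  to (inj₂ (sizedPair eq p q)) = sizedPair (cong suc eq) p q

  from : SizedPair P Q (suc n) → (P 0 × Q (suc n)) ⊎ SizedPair (P ∘ suc) Q n
  from (sizedPair {zero}  refl p q) = inj₁ (p , q)
  from (sizedPair {suc _} refl p q) = inj₂ (sizedPair refl p q)

-- The cardinality is a rational number so that it can be compared directly with coefficients of
-- power series.
Card : Set → ℚ → Set
Card S q = Σ[ k ∈ ℕ ] (Fin k ↔ S) × + k / 1 ≡ q

card-↔ : ∀ {S T q} → S ↔ T → Card S q → Card T q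
card-↔ S↔T (k , k↔S , eq) = k , S↔T ↔-∘ k↔S , eq

-- The passage from bijections to identities of coefficients: the two sides count the same set.
card-unique : ∀ {S p q} → Card S p → Card S q → p ≡ q
card-unique (k , k↔S , refl) (l , l↔S , refl) =
  cong (λ n → + n / 1) (Perm.↔⇒≡ (↔-sym l↔S ↔-∘ k↔S))

finite⇒card : ∀ {S} (fin : Finite S) → Card S (+ proj₁ fin / 1)
finite⇒card (k , k↔S) = k , k↔S , refl

card-empty : ∀ {S} → ¬ S → Card S 0ℚ
card-empty ¬s = 0 , mk↔ₛ′ (λ ()) (λ s → contradiction s ¬s) (λ s → contradiction s ¬s) (λ ()) , refl

card-singleton : ∀ {S} (s : S) → (∀ s′ → s ≡ s′) → Card S 1ℚ
card-singleton s unique = 1 , mk↔ₛ′ (λ _ → s) (λ _ → zero) unique (λ { zero → refl }) , refl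

card-⊎ : ∀ {S T p q} → Card S p → Card T q → Card (S ⊎ T) (p ℚ.+ q)
card-⊎ (k , k↔S , refl) (l , l↔T , refl) =
  k ℕ.+ l , (k↔S ⊎-↔ l↔T) ↔-∘ Fin.+↔⊎ , +-/1 (+ k) (+ l)

card-× : ∀ {S T p q} → Card S p → Card T q → Card (S × T) (p ℚ.* q)
card-× (k , k↔S , refl) (l , l↔T , refl) =
  k ℕ.* l , (k↔S ×-↔ l↔T) ↔-∘ Fin.*↔× , trans (cong (_/ 1) (ℤ.pos-* k l)) (*-/1 (+ k) (+ l))

card-Σ : ∀ n {P : Fin n → Set} {f : Fin n → ℚ} → (∀ i → Card (P i) (f i)) → Card (Σ (Fin n) P) (∑[ i < n ] f i)
card-Σ zero    cards = card-empty λ ()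
card-Σ (suc n) cards = card-↔ Σ-Fin-suc (card-⊎ (cards zero) (card-Σ n (cards ∘ suc)))

card-SizedPair : ∀ {P Q f g} → (∀ n → Card (P n) (f n)) → (∀ n → Card (Q n) (g n)) →
                 ∀ n → Card (SizedPair P Q n) ((f ⊛ g) n)
-- The sum with a single summand still carries a trailing `+ 0ℚ`.
card-SizedPair cardP cardQ zero = subst (Card _) (sym (ℚ.+-identityʳ _))
  (card-↔ SizedPair-zero (card-× (cardP 0) (cardQ 0)))
card-SizedPair cardP cardQ (suc n) = card-↔ SizedPair-suc
  (card-⊎ (card-× (cardP 0) (cardQ (suc n))) (card-SizedPair (cardP ∘ suc) cardQ n))

-- Accounts for the summand x of the tree equation, contributed by the single-vertex tree.
card-≡1 : ∀ n → Card (n ≡ 1) (X n)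
card-≡1 0             = card-empty λ ()
card-≡1 1             = card-singleton refl (≡-irrelevant refl)
card-≡1 (suc (suc n)) = card-empty λ ()

≡-finite : ∀ {n} (i j : Fin n) → Finite (i ≡ j)
≡-finite i j with i Fin.≟ j
... | yes i≡j = let k , k↔ , _ = card-singleton i≡j (≡-irrelevant i≡j) in k , k↔
... | no  i≢j = let k , k↔ , _ = card-empty i≢j in k , k↔

fibre-↔ : ∀ {I S : Set} {P : I → Set} (S↔ΣP : S ↔ Σ I P) i →
          (Σ[ s ∈ S ] proj₁ (Inverse.to S↔ΣP s) ≡ i) ↔ P i
fibre-↔ {I} {S} {P} S↔ΣP i =
  mk↔ₛ′ (λ { ((_ , p) , refl) → p }) (λ p → (i , p) , refl) (λ _ → refl) (λ { (_ , refl) → refl })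
  ↔-∘ Σ.cong {A = λ s → proj₁ (Inverse.to S↔ΣP s) ≡ i} {B = λ t → proj₁ t ≡ i} {k = bijection} S↔ΣP (λ {_} → ↔-id _)

-- After enumerating the total space by `Fin k`, `P i` is the fibre over `i` of a map from `Fin k`
-- to `Fin m`, hence a finite sum of decidable equalities.
fibre-finite : ∀ {m} {P : Fin m → Set} → Finite (Σ (Fin m) P) → ∀ i → Finite (P i)
fibre-finite (k , k↔) i =
  let l , l↔ , _ = card-↔ (fibre-↔ k↔ i) (card-Σ k λ s → finite⇒card (≡-finite (proj₁ (Inverse.to k↔ s)) i))
  in l , l↔

-- Colored trees

-- graft eq a s t is the tree t with s added as a new leftmost child of its root.
data Rooted {m} (A : ColoringMatrix m) : Fin m → ℕ → Set where
  leaf  : ∀ {i} → Rooted A i 1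
  graft : ∀ {i j k l n} → k ℕ.+ l ≡ n → A i j ≡ 1F →
          Rooted A j k → Rooted A i l → Rooted A i n

Rooted-nonempty : ∀ {m} {A : ColoringMatrix m} {i} → ¬ Rooted A i 0
Rooted-nonempty (graft {k = zero} eq a s t) = Rooted-nonempty s

module _ {m : ℕ} {A : ColoringMatrix m} where

  -- What remains of a tree with `n` vertices once its root color `i` is fixed; the `suc` counts the
  -- root.
  Forest : Fin m → ℕ → Set
  Forest i n = Σ[ ts ∈ List PlaneTree ] Σ[ cs ∈ All (Coloring m) ts ]
               ChildrenOK A i cs × suc (#verticesᶠ ts) ≡ n

  decompose : ∀ {i ts} (cs : All (Coloring m) ts) → ChildrenOK A i cs →
              Rooted A i (suc (#verticesᶠ ts))
  decompose []                    tt          = leaf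
  decompose (node {us} j ds ∷ cs) (a , p , q) =
    -- The root is counted with the remaining siblings, so the `suc` has to move from the second
    -- summand to the whole sum.
    graft (ℕ.+-suc (suc (#verticesᶠ us)) _) a (decompose ds p) (decompose cs q)

  attach : ∀ {i j k l n} → k ℕ.+ l ≡ n → A i j ≡ 1F → Forest j k → Forest i l → Forest i n
  attach eq a (us , ds , p , refl) (ts , cs , q , refl) =
    node us ∷ ts , node _ ds ∷ cs , (a , p , q) , trans (sym (ℕ.+-suc (suc (#verticesᶠ us)) _)) eq

  assemble : ∀ {i n} → Rooted A i n → Forest i n
  assemble leaf             = [] , [] , tt , refl
  assemble (graft eq a s t) = attach eq a (assemble s) (assemble t)

  assemble-decompose : ∀ {i ts} (cs : All (Coloring m) ts) (ok : ChildrenOK A i cs) →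
                       assemble (decompose cs ok) ≡ (ts , cs , ok , refl)
  assemble-decompose []               tt          = refl
  assemble-decompose {ts = t ∷ ts} (node j ds ∷ cs) (a , p , q)
    rewrite assemble-decompose ds p | assemble-decompose cs q =
    -- Only the proofs of the size equation still differ.
    cong (λ e → t ∷ ts , node j ds ∷ cs , (a , p , q) , e) (≡-irrelevant _ _)

  decompose′ : ∀ {i n} → Forest i n → Rooted A i n
  decompose′ (ts , cs , ok , eq) = subst (Rooted A _) eq (decompose cs ok)

  -- Lets the transport along the size in `decompose′` be absorbed into the equation stored by
  -- `graft`.
  subst-graft : ∀ {i j k l n n′} (e : n ≡ n′) (eq : k ℕ.+ l ≡ n) (eq′ : k ℕ.+ l ≡ n′)
                (a : A i j ≡ 1F) (s : Rooted A j k) (t : Rooted A i l) →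
                subst (Rooted A i) e (graft eq a s t) ≡ graft eq′ a s t
  subst-graft refl eq eq′ a s t = cong (λ e → graft e a s t) (≡-irrelevant eq eq′)

  decompose-attach : ∀ {i j k l n} (eq : k ℕ.+ l ≡ n) (a : A i j ≡ 1F) (s : Forest j k) (t : Forest i l) →
                     decompose′ (attach eq a s t) ≡ graft eq a (decompose′ s) (decompose′ t)
  decompose-attach eq a (us , ds , p , refl) (ts , cs , q , refl) =
    subst-graft _ _ eq a (decompose ds p) (decompose cs q)

  decompose-assemble : ∀ {i n} (t : Rooted A i n) → decompose′ (assemble t) ≡ t
  decompose-assemble leaf             = refl
  decompose-assemble (graft eq a s t) = trans
    (decompose-attach eq a (assemble s) (assemble t))
    (cong₂ (graft eq a) (decompose-assemble s) (decompose-assemble t))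

  ColoredTree↔Rooted : ∀ n → ColoredTree A n ↔ (Σ[ i ∈ Fin m ] Rooted A i n)
  ColoredTree↔Rooted n = mk↔ₛ′ to from
    (λ (i , t) → cong (i ,_) (decompose-assemble t))
    (λ { (node ts , refl , node i cs , ok) → cong (tree i) (assemble-decompose cs ok) })
    where
    tree : ∀ i → Forest i n → ColoredTree A n
    tree i (ts , cs , ok , eq) = node ts , eq , node i cs , ok

    to : ColoredTree A n → Σ[ i ∈ Fin m ] Rooted A i n
    to (node ts , eq , node i cs , ok) = i , decompose′ (ts , cs , ok , eq)

    from : (Σ[ i ∈ Fin m ] Rooted A i n) → ColoredTree A n
    from (i , t) = tree i (assemble t)

-- One layer of the recursion as a set-level equation; counting both sides gives the functional
-- equation for the series with root color `i`.
Rooted-unfold : ∀ {m} (A : ColoringMatrix m) i n →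
  (n ≡ 1 ⊎ SizedPair (λ k → Σ[ j ∈ Fin m ] (A i j ≡ 1F × Rooted A j k)) (Rooted A i) n) ↔ Rooted A i n
Rooted-unfold A i n = mk↔ₛ′
  (λ { (inj₁ refl) → leaf ; (inj₂ (sizedPair eq (_ , a , s) t)) → graft eq a s t })
  (λ { leaf → inj₁ refl ; (graft eq a s t) → inj₂ (sizedPair eq (_ , a , s) t) })
  (λ { leaf → refl ; (graft eq a s t) → refl })
  (λ { (inj₁ refl) → refl ; (inj₂ (sizedPair eq (_ , a , s) t)) → refl })

-- If no allowed child leaves the image of `ι`, a tree whose root color lies in the image has all
-- its colors there. It is therefore the same as a tree for the submatrix `A`.
module _ {m n : ℕ} {A : ColoringMatrix m} {B : ColoringMatrix n} (ι : Fin m → Fin n)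
         (ι-injective : ∀ {i j} → ι i ≡ ι j → i ≡ j)
         (ι-preserves : ∀ i j → B (ι i) (ι j) ≡ A i j)
         (ι-closed    : ∀ i j → B (ι i) j ≡ 1F → ∃[ j′ ] ι j′ ≡ j) where

  embed : ∀ {i k} → Rooted A i k → Rooted B (ι i) k
  embed leaf             = leaf
  embed (graft eq a s t) = graft eq (trans (ι-preserves _ _) a) (embed s) (embed t)

  restrict : ∀ {i k} → Rooted B (ι i) k → Rooted A i k
  restrict leaf = leaf
  restrict {i} (graft {j = j} eq b s t) with ι-closed i j b
  ... | j′ , refl = graft eq (trans (sym (ι-preserves i j′)) b) (restrict s) (restrict t)

  restrict-embed : ∀ {i k} (t : Rooted A i k) → restrict (embed t) ≡ t
  restrict-embed leaf = refl
  restrict-embed {i} (graft {j = j} eq a s t) with ι-closed i (ι j) (trans (ι-preserves i j) a)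
  -- `ι-closed` may return a `j′` other than `j`; injectivity identifies the two before the equation
  -- `e` can be matched.
  ... | j′ , e with ι-injective e
  restrict-embed {i} (graft {j = j} eq a s t) | j′ , refl | refl
    rewrite restrict-embed s | restrict-embed t = cong (λ a → graft eq a s t) (≡-irrelevant _ a)

  embed-restrict : ∀ {i k} (t : Rooted B (ι i) k) → embed (restrict t) ≡ t
  embed-restrict leaf = refl
  embed-restrict {i} (graft {j = j} eq b s t) with ι-closed i j b
  ... | j′ , refl rewrite embed-restrict s | embed-restrict t =
    cong (λ b → graft eq b s t) (≡-irrelevant _ b)

  Rooted-↔ : ∀ i k → Rooted A i k ↔ Rooted B (ι i) k
  Rooted-↔ i k = mk↔ₛ′ embed restrict embed-restrict restrict-embed

-- The extended matrix

identity-refl : ∀ n (i : Fin n) → identity n i i ≡ 1F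
identity-refl n i with i Fin.≟ i
... | yes _  = refl
... | no i≢i = contradiction refl i≢i

identity≡1⇒≡ : ∀ n {i j : Fin n} → identity n i j ≡ 1F → i ≡ j
identity≡1⇒≡ n {i} {j} p with i Fin.≟ j
... | yes i≡j = i≡j

module _ {m : ℕ} (A : ColoringMatrix m) (m′ : ℕ) where

  extend-ˡˡ : ∀ i j → extend A m′ (i ↑ˡ m′) (j ↑ˡ m′) ≡ A i j
  extend-ˡˡ i j = trans
    (cong (λ row → row (j ↑ˡ m′)) (lookup-++ˡ (zipWith _++_ A (zeros m m′)) _ i))
    (lookup-++ˡ (A i) (zeros m m′ i) j)

  extend-ˡʳ : ∀ i j → extend A m′ (i ↑ˡ m′) (m ↑ʳ j) ≡ 0F
  extend-ˡʳ i j = trans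
    (cong (λ row → row (m ↑ʳ j)) (lookup-++ˡ (zipWith _++_ A (zeros m m′)) _ i))
    (lookup-++ʳ (A i) (zeros m m′ i) j)

  extend-ʳˡ : ∀ i j → extend A m′ (m ↑ʳ i) (j ↑ˡ m′) ≡ 1F
  extend-ʳˡ i j = trans
    (cong (λ row → row (j ↑ˡ m′)) (lookup-++ʳ (zipWith _++_ A (zeros m m′)) _ i))
    (lookup-++ˡ (ones m′ m i) (identity m′ i) j)

  extend-ʳʳ : ∀ i j → extend A m′ (m ↑ʳ i) (m ↑ʳ j) ≡ identity m′ i j
  extend-ʳʳ i j = trans
    (cong (λ row → row (m ↑ʳ j)) (lookup-++ʳ (zipWith _++_ A (zeros m m′)) _ i))
    (lookup-++ʳ (ones m′ m i) (identity m′ i) j)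

  -- This is the zero block: a new color below an old one would give `0F ≡ 1F`.
  ↑ˡ-closed : ∀ i j → extend A m′ (i ↑ˡ m′) j ≡ 1F → ∃[ j′ ] j′ ↑ˡ m′ ≡ j
  ↑ˡ-closed i j a with splitAt m j in eq
  ... | inj₁ j′ = j′ , Fin.splitAt⁻¹-↑ˡ eq
  ... | inj₂ j′ with trans (sym (extend-ˡʳ i j′)) (trans (cong (extend A m′ (i ↑ˡ m′)) (Fin.splitAt⁻¹-↑ʳ eq)) a)
  ...   | ()

  Rooted-old : ∀ i k → Rooted A i k ↔ Rooted (extend A m′) (i ↑ˡ m′) k
  Rooted-old = Rooted-↔ (_↑ˡ m′) (Fin.↑ˡ-injective m′ _ _) extend-ˡˡ ↑ˡ-closed

  -- In a new row the all-ones block admits every old color, and the identity block admits only `i`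
  -- itself.
  new-children : ∀ i k →
    (Σ[ j ∈ Fin m ] Rooted A j k ⊎ Rooted (extend A m′) (m ↑ʳ i) k) ↔
    (Σ[ j ∈ Fin (m ℕ.+ m′) ] (extend A m′ (m ↑ʳ i) j ≡ 1F × Rooted (extend A m′) j k))
  new-children i k = Σ-Fin-+ m ↔-∘
    (Σ.congˡ {k = bijection} (λ {j} → ×-inhabited ≡-irrelevant (extend-ʳˡ i j) ↔-∘ Rooted-old j k)
     ⊎-↔
     Σ-singleton {P = λ j → Rooted (extend A m′) (m ↑ʳ j) k} ≡-irrelevant (trans (extend-ʳʳ i i) (identity-refl m′ i))
       (λ {j} a → identity≡1⇒≡ m′ (trans (sym (extend-ʳʳ i j)) a)))

-- Abstract because conversion checking would otherwise unfold the enumeration inside R.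
abstract
  Rooted-finite : ∀ {m} (A : ColoringMatrix m) i n → Finite (Rooted A i n)
  Rooted-finite A i n =
    fibre-finite (_ , ColoredTree↔Rooted n ↔-∘ proj₂ (ColoredTree-finite A n)) i

-- Generating series by root color.

R : ∀ {m} → ColoringMatrix m → Fin m → PowerSeries
R A i n = + proj₁ (Rooted-finite A i n) / 1

card-Rooted : ∀ {m} (A : ColoringMatrix m) i n → Card (Rooted A i n) (R A i n)
card-Rooted A i n = finite⇒card (Rooted-finite A i n)

card-ΣRooted : ∀ {m} (A : ColoringMatrix m) n → Card (Σ[ i ∈ Fin m ] Rooted A i n) (F A n)
-- `F` is 0 by definition at size 0, in agreement with the absence of empty trees.
card-ΣRooted A zero    = card-empty λ (_ , t) → Rooted-nonempty t
card-ΣRooted A (suc n) = card-↔ (ColoredTree↔Rooted (suc n)) (finite⇒card (ColoredTree-finite A (suc n)))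

R-zero : ∀ {m} (A : ColoringMatrix m) i → R A i 0 ≡ 0ℚ
R-zero A i = card-unique (card-Rooted A i 0) (card-empty Rooted-nonempty)

module _ {m : ℕ} (A : ColoringMatrix m) (m′ : ℕ) where

  private
    A′ = extend A m′
    G : Fin m′ → PowerSeries
    G i = R A′ (m ↑ʳ i)

  -- Both sides count the trees with root color `m ↑ʳ i`; the leftmost subtree ranges over
  -- `new-children`, which are counted by `F A ⊕ G i`.
  G-equation : ∀ i → G i ≈ X ⊕ (F A ⊕ G i) ⊛ G i
  G-equation i n = card-unique (card-Rooted A′ (m ↑ʳ i) n)
    (card-↔ (Rooted-unfold A′ (m ↑ʳ i) n)
      (card-⊎ (card-≡1 n)
        (card-SizedPair {Q = Rooted A′ (m ↑ʳ i)} (λ k → card-↔ (new-children A m′ i k) (card-⊎ (card-ΣRooted A k) (card-Rooted A′ (m ↑ʳ i) k)))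
          (card-Rooted A′ (m ↑ʳ i)) n)))

  F-extend : F A′ ≈ λ n → F A n ℚ.+ ∑[ i < m′ ] G i n
  F-extend n = card-unique (card-ΣRooted A′ n)
    (card-↔ (Σ-Fin-+ m)
      (card-⊎ (card-↔ (Σ.congˡ {k = bijection} (λ {i} → Rooted-old A m′ i n)) (card-ΣRooted A n))
              (card-Σ m′ λ i → card-Rooted A′ (m ↑ʳ i) n)))

  G-independent : ∀ i j → G i ≈ G j
  G-independent i j = fixpoint-unique {F A} {G i} {G j} refl
    (R-zero A′ (m ↑ʳ i)) (R-zero A′ (m ↑ʳ j)) (G-equation i) (G-equation j)

  F-extend-via : ∀ i → F A′ ≈ F A ⊕ (+ m′ / 1) · G i
  F-extend-via i n = trans (F-extend n) (cong (F A n ℚ.+_) (trans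
    (sum-cong-≗ λ j → G-independent j i n)
    (∑-const m′ (G i n))))

theorem27 : ∀ {m : ℕ} (A : ColoringMatrix m) (m′ : ℕ) .{{_ : NonZero m′}} →
    let F₀ = F A
        F′ = F (extend A m′)
        B  = const (+ m′ / 1) ⊖ ((+ m′ - + 2) / 1) · F₀
        D  = B ² ⊖ (+ 4 / 1) · ((+ m′ / 1) · F₀ ⊖ ((+ m′ - + 1) / 1) · F₀ ² ⊕ ((+ m′ * + m′) / 1) · X)
    in
    ((+ 1 / m′) · F′ ²
      ⊕ (((+ m′ - + 2) / m′) · F₀ ⊖ const 1ℚ) ⊛ F′
      ⊕ (F₀ ⊖ ((+ m′ - + 1) / m′) · F₀ ² ⊕ (+ m′ / 1) · X)
      ≈ const 0ℚ)
    × (∃[ S ] S IsSqrtOf D)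
    × (∀ S → S IsSqrtOf D → F′ ≈ ½ · B ⊖ ½ · S)
theorem27 A m′@(suc _) =
  quadratic-divided {μ} {c} {f = F₀} {F′} μc≡1
    (trans (/-as-* (+ m′ - + 2) m′) (cong (ℚ._* c) μ-2))
    (trans (/-as-* (+ m′ - + 1) m′) (cong (ℚ._* c) μ-1))
    quad ,
  -- This witness shows that the formula for every square root `S` is not vacuous.
  (T , √T) ,
  λ S √S n → trans (half-difference B F′ n) (cong (λ s → ½ ℚ.* B n ℚ.- ½ ℚ.* s) (sqrt-unique √T √S n))
  where
  F₀ = F A
  F′ = F (extend A m′)
  μ  = + m′ / 1
  c  = + 1 / m′
  B  = const μ ⊖ ((+ m′ - + 2) / 1) · F₀
  T  = B ⊖ 2ℚ · F′
  D  = B ² ⊖ (+ 4 / 1) · (μ · F₀ ⊖ ((+ m′ - + 1) / 1) · F₀ ² ⊕ ((+ m′ * + m′) / 1) · X)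

  quad : Quadratic μ F₀ F′
  -- Since `m′` is a successor, `zero` is available as a representative new color.
  quad = quadratic {F₀} {F′} {R (extend A m′) (_ ↑ʳ zero)} μ (F-extend-via A m′ zero) (G-equation A m′ zero)

  μ-2 : (+ m′ - + 2) / 1 ≡ μ ℚ.- 2ℚ
  μ-2 = +-/1 (+ m′) (ℤ.- + 2)

  μ-1 : (+ m′ - + 1) / 1 ≡ μ ℚ.- 1ℚ
  μ-1 = +-/1 (+ m′) (ℤ.- + 1)

  μc≡1 : μ ℚ.* c ≡ 1ℚ
  μc≡1 = trans (sym (/-as-* (+ m′) m′)) (n/n≡1 m′)

  √T : T IsSqrtOf D
  √T = record
    { squares  = quadratic-discriminant {μ} {f = F₀} {F′} μ-2 μ-1 (*-/1 (+ m′) (+ m′)) quad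
    ; positive = subst (0ℚ ℚ.<_) (sym (sqrt-constant-term {μ} {(+ m′ - + 2) / 1} {F₀} {F′} refl refl))
        (ℚ.positive⁻¹ μ {{ℚ.normalize-pos m′ 1}})
    }
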